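{- Let $d,q\geq 2$ be integers with $d\mid q$. Then for every $x\in\mathbb{Z}$, the natural density of $\{n\in\mathbb{N}: u_q(n)+x\equiv 0\pmod d\}$ exists and equals $$\frac{1}{d^2}\sum_{f\mid\gcd(x,d)}f\cdot\varphi\!\left(\frac{d}{f}\right),$$ where the sum runs over positive divisors $f$ of $\gcd(x,d)$ and $\varphi$ is Euler's totient function.
   Context: For an integer $q\geq 2$ and $n\in\mathbb{N}$: $v_q(0)=0$ and, for $n>0$, $v_q(n)=\max\{k: q^k\mid n\}$; $w_q(n)=\sum_{i=0}^n v_q(i)$; $u_q(n)=\sum_{i=0}^n w_q(i)$. The natural density of $T\subseteq\mathbb{N}$ is $\lim_{N\to\infty}|\{n\in T: 0\leq n<N\}|/N$. -}

module Defs where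

import Data.Integer.Base as ℤ
open import Data.List.Base using (filter; length; map; upTo)
open import Data.List.Extrema.Nat using (max; argmax-sel; xs≤max)
open import Data.List.Membership.Propositional.Properties using (∈-filter⁺; ∈-filter⁻; ∈-upTo⁺)
open import Data.List.Relation.Unary.All using (lookup)
open import Data.Nat.Base
open import Data.Nat.Coprimality using (coprime?)
open import Data.Nat.Divisibility using (_∣_; _∣?_; ∣⇒≤; 1∣_)
open import Data.Nat.ListAction using (sum)
open import Data.Nat.Properties
open import Data.Product.Base using (_×_; _,_; proj₂; ∃-syntax)
open import Data.Rational.Base as ℚ using (ℚ; 0ℚ)
open import Data.Sum.Base using (inj₁; inj₂)
open import Function.Base using (id)
open import Level using (Level)
open import Relation.Binary.PropositionalEquality using (cong; subst; sym)
open import Relation.Unary using (Pred; Decidable)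

private
  variable
    ℓ : Level

-- For n > 0 and q ≥ 2 the bound k ≤ n on the candidates loses nothing, because
-- q ^ k ∣ n forces k < q ^ k ≤ n; see v-maximum.
v : ℕ → ℕ → ℕ
v q zero      = 0
v q n@(suc _) = max 0 (filter (λ k → q ^ k ∣? n) (upTo (suc n)))

k<q^k : ∀ {q} → 2 ≤ q → ∀ k → k < q ^ k
k<q^k 2≤q zero = s≤s z≤n
k<q^k {q} 2≤q (suc k) = begin
  suc (suc k)   ≤⟨ +-mono-≤ (≤-trans (s≤s z≤n) (k<q^k 2≤q k)) (k<q^k 2≤q k) ⟩
  q ^ k + q ^ k ≡⟨ cong (q ^ k +_) (+-identityʳ (q ^ k)) ⟨
  2 * q ^ k     ≤⟨ *-monoˡ-≤ (q ^ k) 2≤q ⟩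
  q * q ^ k     ∎
  where
  open ≤-Reasoning

v-maximum : ∀ {q n} → 2 ≤ q → 0 < n →
            q ^ v q n ∣ n × (∀ k → q ^ k ∣ n → k ≤ v q n)
v-maximum {q} {n@(suc _)} 2≤q _ = divides-n , upper-bound
  where
  P? : Decidable (λ k → q ^ k ∣ n)
  P? k = q ^ k ∣? n

  divides-n : q ^ v q n ∣ n
  divides-n with argmax-sel id 0 (filter P? (upTo (suc n)))
  ... | inj₁ v≡0 = subst (λ k → q ^ k ∣ n) (sym v≡0) (1∣ n)
  ... | inj₂ v∈  = proj₂ (∈-filter⁻ P? {xs = upTo (suc n)} v∈)

  upper-bound : ∀ k → q ^ k ∣ n → k ≤ v q n
  upper-bound k q^k∣n = lookup (xs≤max 0 (filter P? (upTo (suc n))))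
    (∈-filter⁺ P? (∈-upTo⁺ (m≤n⇒m≤1+n (≤-trans (k<q^k 2≤q k) (∣⇒≤ q^k∣n)))) q^k∣n)

w : ℕ → ℕ → ℕ
w q n = sum (map (v q) (upTo (suc n)))

u : ℕ → ℕ → ℕ
u q n = sum (map (w q) (upTo (suc n)))

φ : ℕ → ℕ
φ n = length (filter (λ k → coprime? k n) (map suc (upTo n)))

-- The sum of F f over the positive divisors f of g, for g > 0 (it is 0 for g = 0).
-- The candidates 1, …, g are produced as successors so that F may divide by f.
sumDivisors : ℕ → ((f : ℕ) .{{_ : NonZero f}} → ℕ) → ℕ
sumDivisors g F = sum (map (λ k → F (suc k)) (filter (λ k → suc k ∣? g) (upTo g)))

infix 10 sumDivisors
syntax sumDivisors g (λ f → t) = ∑[ f ∣ g ] t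

countBelow : {T : Pred ℕ ℓ} → Decidable T → ℕ → ℕ
countBelow T? N = length (filter T? (upTo N))

-- The limit exists and equals δ. As δ is rational, rational ε give the usual notion of
-- a real limit. The decision procedure only serves to count.
HasNaturalDensity : {T : Pred ℕ ℓ} → Decidable T → ℚ → Set
HasNaturalDensity T? δ =
  ∀ (ε : ℚ) → 0ℚ ℚ.< ε →
  ∃[ N₀ ] ∀ (N : ℕ) .{{_ : NonZero N}} → N₀ ≤ N →
  ℚ.∣ (ℤ.+ countBelow T? N) ℚ./ N ℚ.- δ ∣ ℚ.< ε

{-# OPTIONS --safe #-}

-- Summing the valuation over blocks of length q gives w (m q + r) = m + w m for r < q, and
-- summing once more, u (m q + r) ≡ (r + 1) (m + w m) mod q. With m = k q + s the last factor
-- is congruent to (k + w k) + s. So on the block of n = k q² + s q + r, with k fixed and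
-- s, r < q, the values of u (n) mod d are those of products of two factors running
-- independently and uniformly over the residues mod d: every block of length q² contains
-- exactly (q / d)² C hits, where C counts the pairs (s, r) mod d with d ∣ r s + x. For fixed
-- s with f = gcd (s, d) there are f such r if f ∣ x and none otherwise, and φ (d / f)
-- residues s have gcd f with d; hence C = Σ_{f ∣ gcd (x, d)} f φ (d / f).
module Submission where

open import Defs
open import Data.Bool.Base using (true; false; if_then_else_)
open import Data.Nat.Base using (ℕ; >-nonZero; _≤_; _*_; _^_; _/_)
open import Data.Nat.Base as ℕ
  using (zero; suc; _<_; _⊔_; _%_; ∣_-_∣; NonZero; z≤n; s≤s; ≢-nonZero; ≢-nonZero⁻¹)
open import Data.Nat.Properties using (m^n≢0; <⇒≤)
import Data.Nat.Properties as ℕ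
open import Data.Nat.Coprimality
  using (Coprime; coprime?; coprime-/gcd; coprime-divisor; coprime-Bézout; coprime⇒gcd≡1; gcd≡1⇒coprime)
import Data.Nat.Coprimality as Coprime
open import Data.Nat.DivMod using (m≡m%n+[m/n]*n; m%n<n; m%n≤n; m*n/n≡m; m*[n/m]≡n)
open import Data.Nat.Divisibility using (_∣_)
open import Data.Nat.Divisibility as ∣ using (divides; m∣m*n; n∣m*n)
open import Data.Nat.GCD using (gcd)
open import Data.Nat.GCD as GCD using (gcd[m,n]∣m; gcd[m,n]∣n; gcd-greatest; module Bézout)
open import Data.Nat.ListAction using (sum)
open import Data.Nat.Tactic.RingSolver using (solve-∀)
open import Data.Integer.Base using (ℤ; +_; ∣_∣; _+_)
import Data.Integer.Base as ℤ
import Data.Integer.Properties as ℤ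
import Data.Integer.DivMod as ℤ
open import Data.Integer.Divisibility.Signed using (_∣?_)
import Data.Integer.Divisibility.Signed as ℤ∣
import Data.Rational.Base as ℚ
open import Data.Rational.Base using (0ℚ)
import Data.Rational.Properties as ℚ
import Data.Rational.Unnormalised.Base as ℚᵘ
import Data.Rational.Unnormalised.Properties as ℚᵘ
open import Data.List.Base using (map; filter; length; upTo; applyUpTo)
open import Data.List.Properties using (map-upTo)
open import Data.Product.Base using (_,_; proj₁; proj₂; ∃-syntax)
open import Data.Sum.Base using (inj₂)
open import Function.Base using (_∘_)
open import Function.Bundles using (_⇔_; mk⇔; Equivalence)
open import Level using (Level)
open import Relation.Binary.PropositionalEquality
  using (_≡_; _≢_; refl; sym; trans; cong; cong₂; subst; subst₂; module ≡-Reasoning)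
open import Relation.Nullary using (Dec; yes; no; does; ¬_; contradiction)
open import Relation.Nullary.Decidable using (does-⇔; dec-true; dec-false)
open import Relation.Unary using (Pred; Decidable)

private
  variable
    a p : Level
    A : Set a
    P Q : Set p
    d : ℕ
    f g : ℕ → ℕ

-- Indicators of decidable propositions.

𝟙 : Dec P → ℕ
𝟙 P? = if does P? then 1 else 0

𝟙-⇔ : P ⇔ Q → (P? : Dec P) (Q? : Dec Q) → 𝟙 P? ≡ 𝟙 Q?
𝟙-⇔ P⇔Q P? Q? = cong (if_then 1 else 0) (does-⇔ P⇔Q P? Q?)

𝟙-true : (P? : Dec P) → P → 𝟙 P? ≡ 1
𝟙-true P? x = cong (if_then 1 else 0) (dec-true P? x)

𝟙-false : (P? : Dec P) → ¬ P → 𝟙 P? ≡ 0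
𝟙-false P? ¬x = cong (if_then 1 else 0) (dec-false P? ¬x)

𝟙≤1 : (P? : Dec P) → 𝟙 P? ≤ 1
𝟙≤1 (yes _) = s≤s z≤n
𝟙≤1 (no  _) = z≤n

-- Under a divisibility indicator a summand may thus be rewritten with that divisibility as a
-- hypothesis.
𝟙-*-cong : (P? : Dec P) {m n : ℕ} → (P → m ≡ n) → 𝟙 P? * m ≡ 𝟙 P? * n
𝟙-*-cong (yes x) m≡n = cong (1 *_) (m≡n x)
𝟙-*-cong (no  _) m≡n = refl

-- Finite sums over initial segments of ℕ.

-- The recursion peels off the first term, as `applyUpTo` does, so vanishing initial terms disappear
-- by computation.
sumBelow : ℕ → (ℕ → ℕ) → ℕ
sumBelow zero    f = 0
sumBelow (suc n) f = f 0 ℕ.+ sumBelow n (f ∘ suc)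

sumBelow-cong-< : ∀ n → (∀ i → i < n → f i ≡ g i) → sumBelow n f ≡ sumBelow n g
sumBelow-cong-< zero    f≗g = refl
sumBelow-cong-< (suc n) f≗g =
  cong₂ ℕ._+_ (f≗g 0 (s≤s z≤n)) (sumBelow-cong-< n λ i i<n → f≗g (suc i) (s≤s i<n))

sumBelow-cong : ∀ n → (∀ i → f i ≡ g i) → sumBelow n f ≡ sumBelow n g
sumBelow-cong n f≗g = sumBelow-cong-< n λ i _ → f≗g i

sumBelow-const : ∀ n c → sumBelow n (λ _ → c) ≡ n * c
sumBelow-const zero    c = refl
sumBelow-const (suc n) c = cong (c ℕ.+_) (sumBelow-const n c)

sumBelow-zero : ∀ n → (∀ i → i < n → f i ≡ 0) → sumBelow n f ≡ 0
sumBelow-zero n f≗0 =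
  trans (sumBelow-cong-< n f≗0) (trans (sumBelow-const n 0) (ℕ.*-zeroʳ n))

sumBelow-≤ : ∀ n → (∀ i → f i ≤ 1) → sumBelow n f ≤ n
sumBelow-≤ zero    f≤1 = z≤n
sumBelow-≤ (suc n) f≤1 = ℕ.+-mono-≤ (f≤1 0) (sumBelow-≤ n (f≤1 ∘ suc))

sumBelow-*ˡ : ∀ n c → sumBelow n (λ i → c * f i) ≡ c * sumBelow n f
sumBelow-*ˡ         zero    c = sym (ℕ.*-zeroʳ c)
sumBelow-*ˡ {f = f} (suc n) c =
  trans (cong (c * f 0 ℕ.+_) (sumBelow-*ˡ n c)) (sym (ℕ.*-distribˡ-+ c (f 0) _))

sumBelow-+ : ∀ n → sumBelow n (λ i → f i ℕ.+ g i) ≡ sumBelow n f ℕ.+ sumBelow n g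
sumBelow-+                 zero    = refl
sumBelow-+ {f = f} {g = g} (suc n) =
  trans (cong (f 0 ℕ.+ g 0 ℕ.+_) (sumBelow-+ n)) (interchange (f 0) (g 0) _ _)
  where
  interchange : ∀ a b c d → (a ℕ.+ b) ℕ.+ (c ℕ.+ d) ≡ (a ℕ.+ c) ℕ.+ (b ℕ.+ d)
  interchange = solve-∀

sumBelow-swap : ∀ m n (F : ℕ → ℕ → ℕ) →
                sumBelow m (λ i → sumBelow n (F i)) ≡
                sumBelow n (λ j → sumBelow m (λ i → F i j))
sumBelow-swap zero    n F = sym (sumBelow-zero n λ _ _ → refl)
sumBelow-swap (suc m) n F =
  trans (cong (sumBelow n (F 0) ℕ.+_) (sumBelow-swap m n (F ∘ suc)))
        (sym (sumBelow-+ n))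

sumBelow-split : ∀ m n → sumBelow (m ℕ.+ n) f ≡ sumBelow m f ℕ.+ sumBelow n (λ i → f (m ℕ.+ i))
sumBelow-split         zero    n = refl
sumBelow-split {f = f} (suc m) n =
  trans (cong (f 0 ℕ.+_) (sumBelow-split m n)) (sym (ℕ.+-assoc (f 0) _ _))

sumBelow-suc : ∀ n → sumBelow (suc n) f ≡ sumBelow n f ℕ.+ f n
sumBelow-suc {f = f} zero    = ℕ.+-comm (f 0) 0
sumBelow-suc {f = f} (suc n) =
  trans (cong (f 0 ℕ.+_) (sumBelow-suc n)) (sym (ℕ.+-assoc (f 0) _ _))

sumBelow-blocks : ∀ m n → sumBelow (m * n) f ≡ sumBelow m (λ i → sumBelow n (λ j → f (i * n ℕ.+ j)))
sumBelow-blocks         zero    n = refl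
sumBelow-blocks {f = f} (suc m) n = begin
  sumBelow (n ℕ.+ m * n) f
    ≡⟨ sumBelow-split n (m * n) ⟩
  sumBelow n f ℕ.+ sumBelow (m * n) (λ i → f (n ℕ.+ i))
    ≡⟨ cong (sumBelow n f ℕ.+_) (sumBelow-blocks m n) ⟩
  sumBelow n f ℕ.+ sumBelow m (λ i → sumBelow n (λ j → f (n ℕ.+ (i * n ℕ.+ j))))
    ≡⟨ cong (sumBelow n f ℕ.+_) (sumBelow-cong m λ i → sumBelow-cong n λ j →
         cong f (sym (ℕ.+-assoc n (i * n) j))) ⟩
  sumBelow n f ℕ.+ sumBelow m (λ i → sumBelow n (λ j → f (suc i * n ℕ.+ j))) ∎
  where open ≡-Reasoning

sumBelow-single : ∀ {n i₀} → i₀ < n → (∀ i → i < n → i ≢ i₀ → f i ≡ 0) → sumBelow n f ≡ f i₀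
sumBelow-single {f = f} {suc n} {zero} _ f≗0 =
  trans (cong (f 0 ℕ.+_) (sumBelow-zero n λ i i<n → f≗0 (suc i) (s≤s i<n) λ ()))
        (ℕ.+-identityʳ (f 0))
sumBelow-single {f = f} {suc n} {suc i₀} (s≤s i₀<n) f≗0 =
  cong₂ ℕ._+_ (f≗0 0 (s≤s z≤n) λ ())
    (sumBelow-single i₀<n λ i i<n i≢i₀ → f≗0 (suc i) (s≤s i<n) (i≢i₀ ∘ ℕ.suc-injective))

-- Sums of periodic functions.

Periodic : ℕ → (ℕ → ℕ) → Set
Periodic d f = ∀ i → f (d ℕ.+ i) ≡ f i

periodic-* : ∀ m → Periodic d f → Periodic (m * d) f
periodic-*                 zero    per i = refl
periodic-* {d = d} {f = f} (suc m) per i =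
  trans (cong f (ℕ.+-assoc d (m * d) i)) (trans (per (m * d ℕ.+ i)) (periodic-* m per i))

-- Moving the window one step drops `f c` and gains the equal value `f (c + d)`: expand the sum of
-- `suc d` terms at either end and cancel.
sumBelow-shift : Periodic d f → ∀ c → sumBelow d (λ i → f (c ℕ.+ i)) ≡ sumBelow d f
sumBelow-shift                 per zero    = refl
sumBelow-shift {d = d} {f = f} per (suc c) = ℕ.+-cancelˡ-≡ (f (c ℕ.+ 0)) _ _ (begin
  f (c ℕ.+ 0) ℕ.+ sumBelow d (λ i → f (suc c ℕ.+ i))
    ≡⟨ cong (f (c ℕ.+ 0) ℕ.+_) (sumBelow-cong d λ i → cong f (sym (ℕ.+-suc c i))) ⟩
  sumBelow (suc d) (λ i → f (c ℕ.+ i))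
    ≡⟨ sumBelow-suc d ⟩
  sumBelow d (λ i → f (c ℕ.+ i)) ℕ.+ f (c ℕ.+ d)
    ≡⟨ cong₂ ℕ._+_ (sumBelow-shift per c) wrap ⟩
  sumBelow d f ℕ.+ f (c ℕ.+ 0)
    ≡⟨ ℕ.+-comm (sumBelow d f) _ ⟩
  f (c ℕ.+ 0) ℕ.+ sumBelow d f ∎)
  where
  open ≡-Reasoning
  wrap : f (c ℕ.+ d) ≡ f (c ℕ.+ 0)
  wrap = trans (cong f (ℕ.+-comm c d)) (trans (per c) (cong f (sym (ℕ.+-identityʳ c))))

sumBelow-periods : ∀ m → Periodic d f → sumBelow (m * d) f ≡ m * sumBelow d f
sumBelow-periods {d = d} {f = f} m per = begin
  sumBelow (m * d) f                                       ≡⟨ sumBelow-blocks m d ⟩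
  sumBelow m (λ i → sumBelow d (λ j → f (i * d ℕ.+ j)))    ≡⟨ sumBelow-cong m (λ i →
                                                                sumBelow-cong d (periodic-* i per)) ⟩
  sumBelow m (λ _ → sumBelow d f)                          ≡⟨ sumBelow-const m _ ⟩
  m * sumBelow d f                                         ∎
  where open ≡-Reasoning

-- List sums and counts as finite sums.

sum-applyUpTo : ∀ (f : ℕ → ℕ) n → sum (applyUpTo f n) ≡ sumBelow n f
sum-applyUpTo f zero    = refl
sum-applyUpTo f (suc n) = cong (f 0 ℕ.+_) (sum-applyUpTo (f ∘ suc) n)

sum-map-upTo : ∀ (f : ℕ → ℕ) n → sum (map f (upTo n)) ≡ sumBelow n f
sum-map-upTo f n = trans (cong sum (map-upTo f n)) (sum-applyUpTo f n)

sum-map-filter-applyUpTo : {P : Pred A p} (P? : Decidable P) (h : A → ℕ) (g : ℕ → A) (n : ℕ) →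
  sum (map h (filter P? (applyUpTo g n))) ≡ sumBelow n (λ i → 𝟙 (P? (g i)) * h (g i))
sum-map-filter-applyUpTo P? h g zero = refl
sum-map-filter-applyUpTo P? h g (suc n) with does (P? (g 0))
... | true  = cong₂ ℕ._+_ (sym (ℕ.+-identityʳ (h (g 0)))) (sum-map-filter-applyUpTo P? h (g ∘ suc) n)
... | false = sum-map-filter-applyUpTo P? h (g ∘ suc) n

length-filter-applyUpTo : {P : Pred A p} (P? : Decidable P) (g : ℕ → A) (n : ℕ) →
  length (filter P? (applyUpTo g n)) ≡ sumBelow n (λ i → 𝟙 (P? (g i)))
length-filter-applyUpTo P? g zero = refl
length-filter-applyUpTo P? g (suc n) with does (P? (g 0))
... | true  = cong suc (length-filter-applyUpTo P? (g ∘ suc) n)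
... | false = length-filter-applyUpTo P? (g ∘ suc) n

φ-sumBelow : ∀ n → φ n ≡ sumBelow n (λ i → 𝟙 (coprime? (suc i) n))
φ-sumBelow n = trans (cong (length ∘ filter (λ k → coprime? k n)) (map-upTo suc n))
                     (length-filter-applyUpTo (λ k → coprime? k n) suc n)

-- Linear congruences r s + y ≡ 0 mod d.

∣-difference : ∀ {d m n} → d ∣ m → d ∣ n → d ∣ ∣ m - n ∣
∣-difference (divides a refl) (divides b refl) =
  divides ∣ a - b ∣ (sym (ℕ.*-distribʳ-∣-∣ _ a b))

-- The distance is below `d`, and the only multiple of `d` there is 0.
∣-∣-small : ∀ {d m n} → m < d → n < d → d ∣ ∣ m - n ∣ → m ≡ n
∣-∣-small {d} {m} {n} m<d n<d d∣ with ∣ m - n ∣ in eq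
... | zero  = ℕ.∣m-n∣≡0⇒m≡n eq
... | suc k = contradiction (∣.∣⇒≤ d∣) (ℕ.<⇒≱ (begin-strict
    suc k       ≡⟨ eq ⟨
    ∣ m - n ∣   ≤⟨ ℕ.∣m-n∣≤m⊔n m n ⟩
    m ⊔ n       <⟨ ℕ.⊔-lub m<d n<d ⟩
    d           ∎))
  where open ℕ.≤-Reasoning

∣-shift : ∀ {d m n} k → n ≡ k * d ℕ.+ m → (d ∣ n) ⇔ (d ∣ m)
∣-shift {d} k refl = mk⇔ (λ d∣n → ∣.∣m+n∣m⇒∣n d∣n (n∣m*n k)) (∣.∣m∣n⇒∣m+n (n∣m*n k))

solvable : ∀ {s n} → Coprime s n → .{{_ : NonZero n}} → ∀ y → ∃[ r ] n ∣ r * s ℕ.+ y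
solvable {s} {suc n-1} cop y with coprime-Bézout cop
-- Here `t` is inverse to `s`, so r = -t y is wanted; `n-1` serves as -1 mod n within ℕ.
... | Bézout.+- t k eq = t * y * n-1 , divides (y * n-1 * k ℕ.+ y) (begin
    t * y * n-1 * s ℕ.+ y                         ≡⟨ lem₁ t y n-1 s ⟩
    y * n-1 * (t * s) ℕ.+ y                       ≡⟨ cong (λ z → y * n-1 * z ℕ.+ y) (sym eq) ⟩
    y * n-1 * (1 ℕ.+ k * suc n-1) ℕ.+ y           ≡⟨ lem₂ y n-1 k ⟩
    (y * n-1 * k ℕ.+ y) * suc n-1                 ∎)
  where
  open ≡-Reasoning
  lem₁ : ∀ t y m s → t * y * m * s ℕ.+ y ≡ y * m * (t * s) ℕ.+ y
  lem₁ = solve-∀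
  lem₂ : ∀ y m k → y * m * (1 ℕ.+ k * (1 ℕ.+ m)) ℕ.+ y ≡ (y * m * k ℕ.+ y) * (1 ℕ.+ m)
  lem₂ = solve-∀
-- With this sign `t` is already the negative of an inverse of `s`.
... | Bézout.-+ t k eq = t * y , divides (y * k) (begin
    t * y * s ℕ.+ y        ≡⟨ lem t y s ⟩
    y * (1 ℕ.+ t * s)      ≡⟨ cong (y *_) eq ⟩
    y * (k * suc n-1)      ≡⟨ ℕ.*-assoc y k _ ⟨
    y * k * suc n-1        ∎)
  where
  open ≡-Reasoning
  lem : ∀ t y s → t * y * s ℕ.+ y ≡ y * (1 ℕ.+ t * s)
  lem = solve-∀

-- The natural number `y` will be the residue of x mod d, which keeps the counting in ℕ.
solutions : (d s y : ℕ) → ℕ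
solutions d s y = sumBelow d (λ r → 𝟙 (d ∣.∣? r * s ℕ.+ y))

hit-periodic : ∀ d s y → Periodic d (λ r → 𝟙 (d ∣.∣? r * s ℕ.+ y))
hit-periodic d s y r = 𝟙-⇔ (∣-shift s (lem d r s y)) (d ∣.∣? _) (d ∣.∣? _)
  where
  lem : ∀ d r s y → (d ℕ.+ r) * s ℕ.+ y ≡ s * d ℕ.+ (r * s ℕ.+ y)
  lem = solve-∀

solutions-periodic : ∀ d y → Periodic d (λ s → solutions d s y)
solutions-periodic d y s = sumBelow-cong d λ r → 𝟙-⇔ (∣-shift r (lem d r s y)) (d ∣.∣? _) (d ∣.∣? _)
  where
  lem : ∀ d r s y → r * (d ℕ.+ s) ℕ.+ y ≡ r * d ℕ.+ (r * s ℕ.+ y)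
  lem = solve-∀

-- Existence is `solvable` reduced mod n. For two roots `i`, `j` the modulus divides
-- `s * ∣ i - j ∣`, hence `∣ i - j ∣`, and both are below `n`.
solutions-coprime : ∀ {s n} → Coprime s n → .{{_ : NonZero n}} → ∀ y → solutions n s y ≡ 1
solutions-coprime {s} {n} cop y with solvable cop y
... | r , n∣ = trans
  (sumBelow-single (m%n<n r n) λ i i<n i≢ → 𝟙-false (n ∣.∣? _) λ n∣′ → i≢ (unique i i<n n∣′))
  (𝟙-true (n ∣.∣? _) root)
  where
  lem : ∀ a k s y n → (a ℕ.+ k * n) * s ℕ.+ y ≡ k * s * n ℕ.+ (a * s ℕ.+ y)
  lem = solve-∀
  root : n ∣ r % n * s ℕ.+ y
  root = Equivalence.to (∣-shift (r / n * s)
    (trans (cong (λ z → z * s ℕ.+ y) (m≡m%n+[m/n]*n r n)) (lem (r % n) (r / n) s y n))) n∣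
  unique : ∀ i → i < n → n ∣ i * s ℕ.+ y → i ≡ r % n
  unique i i<n n∣′ = ∣-∣-small i<n (m%n<n r n)
    (coprime-divisor (Coprime.sym cop) (subst (n ∣_) eq (∣-difference n∣′ root)))
    where
    open ≡-Reasoning
    j = r % n
    eq : ∣ i * s ℕ.+ y - j * s ℕ.+ y ∣ ≡ s * ∣ i - j ∣
    eq = begin
      ∣ i * s ℕ.+ y - j * s ℕ.+ y ∣    ≡⟨ cong₂ ∣_-_∣ (ℕ.+-comm (i * s) y) (ℕ.+-comm (j * s) y) ⟩
      ∣ y ℕ.+ i * s - y ℕ.+ j * s ∣    ≡⟨ ℕ.∣m+n-m+o∣≡∣n-o∣ y (i * s) (j * s) ⟩
      ∣ i * s - j * s ∣                ≡⟨ ℕ.*-distribʳ-∣-∣ s i j ⟨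
      ∣ i - j ∣ * s                    ≡⟨ ℕ.*-comm ∣ i - j ∣ s ⟩
      s * ∣ i - j ∣                    ∎

-- Cancelling `c` leaves a condition of period `n` with one solution per period, and the range
-- consists of `c` periods.
solutions-scale : ∀ {s n} c → .{{_ : NonZero c}} → Coprime s n → .{{_ : NonZero n}} → ∀ y →
                  solutions (c * n) (c * s) (c * y) ≡ c
solutions-scale {s} {n} c cop y = begin
  solutions (c * n) (c * s) (c * y)
    ≡⟨ sumBelow-cong (c * n) (λ r → 𝟙-⇔ (cancel r) (c * n ∣.∣? _) (n ∣.∣? _)) ⟩
  sumBelow (c * n) (λ r → 𝟙 (n ∣.∣? r * s ℕ.+ y))
    ≡⟨ sumBelow-periods c (hit-periodic n s y) ⟩
  c * solutions n s y
    ≡⟨ cong (c *_) (solutions-coprime cop y) ⟩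
  c * 1
    ≡⟨ ℕ.*-identityʳ c ⟩
  c ∎
  where
  open ≡-Reasoning
  lem : ∀ c r s y → r * (c * s) ℕ.+ c * y ≡ c * (r * s ℕ.+ y)
  lem = solve-∀
  cancel : ∀ r → (c * n ∣ r * (c * s) ℕ.+ c * y) ⇔ (n ∣ r * s ℕ.+ y)
  cancel r = mk⇔ (λ h → ∣.*-cancelˡ-∣ c (subst (c * n ∣_) (lem c r s y) h))
                 (λ h → subst (c * n ∣_) (sym (lem c r s y)) (∣.*-monoʳ-∣ c h))

gcd-nonZero : ∀ s d .{{_ : NonZero d}} → NonZero (gcd s d)
gcd-nonZero s d = ≢-nonZero (GCD.gcd[m,n]≢0 s d (inj₂ (≢-nonZero⁻¹ d)))

-- All three arguments are multiples of the gcd, and dividing it out makes `s` and `d` coprime.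
solutions-gcd∣ : ∀ d s y .{{_ : NonZero d}} → gcd s d ∣ y → solutions d s y ≡ gcd s d
solutions-gcd∣ d s y c∣y = begin
  solutions d s y
    ≡⟨ cong (λ z → solutions z s y) (m*[n/m]≡n c∣d) ⟨
  solutions (c * (d / c)) s y
    ≡⟨ cong₂ (solutions (c * (d / c))) (m*[n/m]≡n c∣s) (m*[n/m]≡n c∣y) ⟨
  solutions (c * (d / c)) (c * (s / c)) (c * (y / c))
    ≡⟨ solutions-scale c (coprime-/gcd s d) (y / c) ⟩
  c ∎
  where
  open ≡-Reasoning
  c = gcd s d
  c∣s = gcd[m,n]∣m s d
  c∣d = gcd[m,n]∣n s d
  instance
    c≢0 : NonZero c
    c≢0 = gcd-nonZero s d
    d/c≢0 : NonZero (d / c)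
    d/c≢0 = ≢-nonZero (GCD.n/gcd[m,n]≢0 s d)

-- The gcd divides `d` and `r * s`, so a solution would make it divide `y`.
solutions-gcd∤ : ∀ d s y → ¬ gcd s d ∣ y → solutions d s y ≡ 0
solutions-gcd∤ d s y c∤y = sumBelow-zero d λ r _ → 𝟙-false (d ∣.∣? _) λ d∣ →
  c∤y (∣.∣m+n∣m⇒∣n (∣.∣-trans (gcd[m,n]∣n s d) d∣) (∣.∣n⇒∣m*n r (gcd[m,n]∣m s d)))

-- Both cases become one sum over divisors f = `suc k`, ready to be interchanged with the sum over
-- `s`: only f = gcd (s, d) can contribute, and it is among the divisors of gcd (y, d) exactly when
-- it divides `y`.
solutions-sumBelow : ∀ d s y .{{_ : NonZero d}} →
  solutions d s y ≡
  sumBelow (gcd y d) (λ k → 𝟙 (suc k ∣.∣? gcd y d) * (suc k * 𝟙 (gcd s d ℕ.≟ suc k)))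
solutions-sumBelow d s y with gcd s d ∣.∣? y
... | no c∤y = trans (solutions-gcd∤ d s y c∤y) (sym (sumBelow-zero (gcd y d) λ k _ → zero-term k))
  where
  zero-term : ∀ k → 𝟙 (suc k ∣.∣? gcd y d) * (suc k * 𝟙 (gcd s d ℕ.≟ suc k)) ≡ 0
  zero-term k = trans
    (𝟙-*-cong (suc k ∣.∣? gcd y d) λ k∣ →
      trans (cong (suc k *_) (𝟙-false (gcd s d ℕ.≟ suc k) λ c≡ →
              c∤y (subst (_∣ y) (sym c≡) (∣.∣-trans k∣ (gcd[m,n]∣m y d)))))
            (ℕ.*-zeroʳ (suc k)))
    (ℕ.*-zeroʳ (𝟙 (suc k ∣.∣? gcd y d)))
... | yes c∣y = trans (solutions-gcd∣ d s y c∣y)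
                      (go (gcd s d) refl (gcd-nonZero s d) (gcd-greatest c∣y (gcd[m,n]∣n s d)))
  where
  -- Abstracting the gcd to `c` allows matching it as `suc k₀`; `k₀` is the index of the surviving
  -- term.
  go : ∀ c → gcd s d ≡ c → NonZero c → c ∣ gcd y d →
       gcd s d ≡ sumBelow (gcd y d) (λ k → 𝟙 (suc k ∣.∣? gcd y d) * (suc k * 𝟙 (gcd s d ℕ.≟ suc k)))
  go (suc k₀) c≡ _ c∣ = trans c≡ (sym (trans
    (sumBelow-single {i₀ = k₀} (∣.∣⇒≤ {{gcd-nonZero y d}} c∣) λ k _ k≢k₀ →
      trans (cong (λ z → 𝟙 (suc k ∣.∣? gcd y d) * (suc k * z))
              (𝟙-false (gcd s d ℕ.≟ suc k) λ c≡′ → k≢k₀ (ℕ.suc-injective (trans (sym c≡′) c≡))))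
            (trans (cong (𝟙 (suc k ∣.∣? gcd y d) *_) (ℕ.*-zeroʳ (suc k)))
                   (ℕ.*-zeroʳ (𝟙 (suc k ∣.∣? gcd y d)))))
    (trans (cong₂ (λ a b → a * (suc k₀ * b))
              (𝟙-true (suc k₀ ∣.∣? gcd y d) c∣) (𝟙-true (gcd s d ℕ.≟ suc k₀) c≡))
           (trans (ℕ.*-identityˡ _) (ℕ.*-identityʳ (suc k₀))))))

-- Residues with a prescribed gcd, and the divisor sum.

-- Cut 1, ..., m c into `m` blocks of length `c`. Only the last entry c (i + 1) of a block is a
-- multiple of `c`, and its gcd with m c is `c` exactly when i + 1 is coprime to `m`.
count-gcd≡ : ∀ m c .{{_ : NonZero c}} →
             sumBelow (m * c) (λ s → 𝟙 (gcd (suc s) (m * c) ℕ.≟ c)) ≡ φ m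
count-gcd≡ m c@(suc c-1) = begin
  sumBelow (m * c) (λ s → 𝟙 (gcd (suc s) (m * c) ℕ.≟ c))
    ≡⟨ sumBelow-blocks m c ⟩
  sumBelow m (λ i → sumBelow c (λ j → 𝟙 (gcd (suc (i * c ℕ.+ j)) (m * c) ℕ.≟ c)))
    ≡⟨ sumBelow-cong m inner ⟩
  sumBelow m (λ i → 𝟙 (coprime? (suc i) m))
    ≡⟨ φ-sumBelow m ⟨
  φ m ∎
  where
  open ≡-Reasoning
  top : ∀ i → suc (i * c ℕ.+ c-1) ≡ c * suc i
  top i = trans (sym (ℕ.+-suc (i * c) c-1)) (trans (ℕ.+-comm (i * c) c) (ℕ.*-comm (suc i) c))
  gcd-top : ∀ i → gcd (suc (i * c ℕ.+ c-1)) (m * c) ≡ c * gcd (suc i) m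
  gcd-top i = trans (cong₂ gcd (top i) (ℕ.*-comm m c)) (sym (GCD.c*gcd[m,n]≡gcd[cm,cn] c (suc i) m))
  coprime⇔ : ∀ i → (gcd (suc (i * c ℕ.+ c-1)) (m * c) ≡ c) ⇔ Coprime (suc i) m
  coprime⇔ i = mk⇔ to from
    where
    to : gcd (suc (i * c ℕ.+ c-1)) (m * c) ≡ c → Coprime (suc i) m
    to eq = gcd≡1⇒coprime (ℕ.*-cancelˡ-≡ _ 1 c (trans (sym (gcd-top i)) (trans eq (sym (ℕ.*-identityʳ c)))))
    from : Coprime (suc i) m → gcd (suc (i * c ℕ.+ c-1)) (m * c) ≡ c
    from cop = trans (gcd-top i) (trans (cong (c *_) (coprime⇒gcd≡1 cop)) (ℕ.*-identityʳ c))
  inner : ∀ i → sumBelow c (λ j → 𝟙 (gcd (suc (i * c ℕ.+ j)) (m * c) ℕ.≟ c)) ≡ 𝟙 (coprime? (suc i) m)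
  inner i = trans
    -- If the gcd is `c`, then `c` divides `suc j`, and `suc j ≤ c` leaves only the last position.
    (sumBelow-single {i₀ = c-1} ℕ.≤-refl λ j j<c j≢ → 𝟙-false (_ ℕ.≟ c) λ eq →
      j≢ (ℕ.suc-injective (ℕ.≤-antisym j<c (∣.∣⇒≤ (∣.∣m+n∣m⇒∣n
        (subst₂ _∣_ eq (sym (ℕ.+-suc (i * c) j)) (gcd[m,n]∣m (suc (i * c ℕ.+ j)) (m * c))) (n∣m*n i))))))
    (𝟙-⇔ (coprime⇔ i) (_ ℕ.≟ c) (coprime? (suc i) m))

count-gcd≡-∣ : ∀ d c .{{_ : NonZero c}} → c ∣ d →
               sumBelow d (λ s → 𝟙 (gcd (suc s) d ℕ.≟ c)) ≡ φ (d / c)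
count-gcd≡-∣ d c (divides m refl) = trans (count-gcd≡ m c) (cong φ (sym (m*n/n≡m m c)))

-- Interchanging the sums groups the residues `s` by their gcd with `d`.
count-pairs : ∀ d y .{{_ : NonZero d}} →
  sumBelow d (λ s → solutions d s y) ≡ ∑[ f ∣ gcd y d ] (f * φ (d / f))
count-pairs d y = begin
  sumBelow d (λ s → solutions d s y)
    -- The residues become 1, ..., d, to match the range over which `φ` counts.
    ≡⟨ sumBelow-shift (solutions-periodic d y) 1 ⟨
  sumBelow d (λ s → solutions d (suc s) y)
    ≡⟨ sumBelow-cong d (λ s → solutions-sumBelow d (suc s) y) ⟩
  sumBelow d (λ s → sumBelow G (λ k → D k * (suc k * 𝟙 (gcd (suc s) d ℕ.≟ suc k))))
    ≡⟨ sumBelow-swap d G _ ⟩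
  sumBelow G (λ k → sumBelow d (λ s → D k * (suc k * 𝟙 (gcd (suc s) d ℕ.≟ suc k))))
    ≡⟨ sumBelow-cong G (λ k → trans (sumBelow-*ˡ d (D k)) (cong (D k *_) (sumBelow-*ˡ d (suc k)))) ⟩
  sumBelow G (λ k → D k * (suc k * sumBelow d (λ s → 𝟙 (gcd (suc s) d ℕ.≟ suc k))))
    ≡⟨ sumBelow-cong G term ⟩
  sumBelow G (λ k → D k * (suc k * φ (d / suc k)))
    ≡⟨ sum-map-filter-applyUpTo (λ k → suc k ∣.∣? G) (λ k → suc k * φ (d / suc k)) (λ k → k) G ⟨
  ∑[ f ∣ G ] (f * φ (d / f)) ∎
  where
  open ≡-Reasoning
  G = gcd y d
  D : ℕ → ℕ
  D k = 𝟙 (suc k ∣.∣? G)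
  term : ∀ k → D k * (suc k * sumBelow d (λ s → 𝟙 (gcd (suc s) d ℕ.≟ suc k))) ≡
               D k * (suc k * φ (d / suc k))
  term k = 𝟙-*-cong (suc k ∣.∣? G) λ k∣ →
    cong (suc k *_) (count-gcd≡-∣ d (suc k) (∣.∣-trans k∣ (gcd[m,n]∣n y d)))

-- The valuation and its iterated sums on blocks of length q.

module _ {q : ℕ} (2≤q : 2 ≤ q) where

  private
    instance
      q≢0 : NonZero q
      q≢0 = >-nonZero (<⇒≤ 2≤q)

  v-∤ : ∀ {n} → ¬ q ∣ n → v q n ≡ 0
  v-∤ {zero}  q∤n = refl
  v-∤ {suc n} q∤n = go (v q (suc n)) (proj₁ (v-maximum 2≤q (s≤s z≤n)))
    where
    go : ∀ k → q ^ k ∣ suc n → k ≡ 0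
    go zero    _    = refl
    go (suc k) q^k∣ = contradiction (∣.∣-trans (m∣m*n (q ^ k)) q^k∣) q∤n

  -- A factor `q` can be attached to a power of `q` dividing `n`, and cancelled from a positive
  -- power dividing `n * q`; maximality gives both bounds.
  v-* : ∀ n → 0 < n → v q (n * q) ≡ suc (v q n)
  v-* n 0<n = ℕ.≤-antisym
    (upper (v q (n * q)) (proj₁ nq-maximum))
    (proj₂ nq-maximum (suc (v q n))
      (subst (_∣ n * q) (ℕ.*-comm (q ^ v q n) q) (∣.*-monoˡ-∣ q (proj₁ n-maximum))))
    where
    n-maximum  = v-maximum 2≤q 0<n
    nq-maximum = v-maximum 2≤q (ℕ.*-mono-≤ 0<n (<⇒≤ 2≤q))
    upper : ∀ k → q ^ k ∣ n * q → k ≤ suc (v q n)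
    upper zero    _    = z≤n
    upper (suc k) q^k∣ = s≤s (proj₂ n-maximum k
      (∣.*-cancelʳ-∣ q (subst (_∣ n * q) (ℕ.*-comm q (q ^ k)) q^k∣)))

  v-block : ∀ m r → r < q → r ≢ 0 → v q (m * q ℕ.+ r) ≡ 0
  v-block m zero    _   r≢0 = contradiction refl r≢0
  v-block m (suc r) r<q _   = v-∤ λ q∣ →
    ℕ.<⇒≱ r<q (∣.∣⇒≤ (∣.∣m+n∣m⇒∣n q∣ (n∣m*n m)))

  -- Only the first entry of a block is a multiple of `q`. A general `r` covers full blocks and the
  -- cut-off last one.
  sumBelow-v-block : ∀ m r → 0 < r → r ≤ q → sumBelow r (λ j → v q (m * q ℕ.+ j)) ≡ v q (m * q)
  sumBelow-v-block m r 0<r r≤q = trans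
    (sumBelow-single 0<r λ j j<r → v-block m j (ℕ.<-≤-trans j<r r≤q))
    (cong (v q) (ℕ.+-identityʳ (m * q)))

  w-block : ∀ m r → r < q → w q (m * q ℕ.+ r) ≡ m ℕ.+ w q m
  w-block m r r<q = begin
    w q (m * q ℕ.+ r)
      ≡⟨ sum-map-upTo (v q) (suc (m * q ℕ.+ r)) ⟩
    sumBelow (suc (m * q ℕ.+ r)) (v q)
      ≡⟨ cong (λ n → sumBelow n (v q)) (ℕ.+-suc (m * q) r) ⟨
    sumBelow (m * q ℕ.+ suc r) (v q)
      ≡⟨ sumBelow-split (m * q) (suc r) ⟩
    sumBelow (m * q) (v q) ℕ.+ sumBelow (suc r) (λ j → v q (m * q ℕ.+ j))
      ≡⟨ cong₂ ℕ._+_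
           (trans (sumBelow-blocks m q) (sumBelow-cong m λ i → sumBelow-v-block i q (<⇒≤ 2≤q) ℕ.≤-refl))
           (sumBelow-v-block m (suc r) (s≤s z≤n) r<q) ⟩
    sumBelow m (λ i → v q (i * q)) ℕ.+ v q (m * q)
      -- The term `v q (0 * q)` is 0 by the convention `v q 0 = 0` and vanishes by computation;
      -- below, `v q 0` is reinserted the same way.
      ≡⟨ sumBelow-suc m ⟨
    sumBelow m (λ i → v q (suc i * q))
      ≡⟨ sumBelow-cong m (λ i → v-* (suc i) (s≤s z≤n)) ⟩
    sumBelow m (λ i → 1 ℕ.+ v q (suc i))
      ≡⟨ sumBelow-+ m ⟩
    sumBelow m (λ _ → 1) ℕ.+ sumBelow (suc m) (v q)
      ≡⟨ cong₂ ℕ._+_ (trans (sumBelow-const m 1) (ℕ.*-identityʳ m)) (sym (sum-map-upTo (v q) (suc m))) ⟩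
    m ℕ.+ w q m ∎
    where open ≡-Reasoning

  -- By `w-block`, `w q` is constant on each block. Full blocks contribute multiples of `q`, the
  -- last one `suc r` equal terms.
  u-block : ∀ m r → r < q →
            u q (m * q ℕ.+ r) ≡ q * sumBelow m (λ i → i ℕ.+ w q i) ℕ.+ suc r * (m ℕ.+ w q m)
  u-block m r r<q = begin
    u q (m * q ℕ.+ r)
      ≡⟨ sum-map-upTo (w q) (suc (m * q ℕ.+ r)) ⟩
    sumBelow (suc (m * q ℕ.+ r)) (w q)
      ≡⟨ cong (λ n → sumBelow n (w q)) (ℕ.+-suc (m * q) r) ⟨
    sumBelow (m * q ℕ.+ suc r) (w q)
      ≡⟨ sumBelow-split (m * q) (suc r) ⟩
    sumBelow (m * q) (w q) ℕ.+ sumBelow (suc r) (λ j → w q (m * q ℕ.+ j))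
      ≡⟨ cong₂ ℕ._+_
           (trans (sumBelow-blocks m q) (sumBelow-cong m λ i → constant i q ℕ.≤-refl))
           (constant m (suc r) r<q) ⟩
    sumBelow m (λ i → q * (i ℕ.+ w q i)) ℕ.+ suc r * (m ℕ.+ w q m)
      ≡⟨ cong (ℕ._+ suc r * (m ℕ.+ w q m)) (sumBelow-*ˡ m q) ⟩
    q * sumBelow m (λ i → i ℕ.+ w q i) ℕ.+ suc r * (m ℕ.+ w q m) ∎
    where
    open ≡-Reasoning
    constant : ∀ i n → n ≤ q → sumBelow n (λ j → w q (i * q ℕ.+ j)) ≡ n * (i ℕ.+ w q i)
    constant i n n≤q = trans
      (sumBelow-cong-< n λ j j<n → w-block i j (ℕ.<-≤-trans j<n n≤q))
      (sumBelow-const n _)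

  u-double-block : ∀ k s r → s < q → r < q →
    ∃[ t ] u q (k * (q * q) ℕ.+ (s * q ℕ.+ r)) ≡ t * q ℕ.+ suc r * (k ℕ.+ w q k ℕ.+ s)
  -- `X` counts the multiples of `q` from the full blocks, `suc r * k` those from the part `k * q`
  -- of `m`.
  u-double-block k s r s<q r<q = X ℕ.+ suc r * k , (begin
    u q (k * (q * q) ℕ.+ (s * q ℕ.+ r))
      ≡⟨ cong (u q) (index k s r q) ⟩
    u q (m * q ℕ.+ r)
      ≡⟨ u-block m r r<q ⟩
    q * X ℕ.+ suc r * (m ℕ.+ w q m)
      ≡⟨ cong (λ z → q * X ℕ.+ suc r * (m ℕ.+ z)) (w-block k s s<q) ⟩
    q * X ℕ.+ suc r * (m ℕ.+ (k ℕ.+ w q k))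
      ≡⟨ collect q X (suc r) k s (w q k) ⟩
    (X ℕ.+ suc r * k) * q ℕ.+ suc r * (k ℕ.+ w q k ℕ.+ s) ∎)
    where
    open ≡-Reasoning
    m = k * q ℕ.+ s
    X = sumBelow m (λ i → i ℕ.+ w q i)
    index : ∀ k s r q → k * (q * q) ℕ.+ (s * q ℕ.+ r) ≡ (k * q ℕ.+ s) * q ℕ.+ r
    index = solve-∀
    collect : ∀ q X R k s W → q * X ℕ.+ R * (k * q ℕ.+ s ℕ.+ (k ℕ.+ W)) ≡
                              (X ℕ.+ R * k) * q ℕ.+ R * (k ℕ.+ W ℕ.+ s)
    collect = solve-∀

-- Hits in a block of length q².

-- The block index `k` enters only through the shift `c` of `s`, which a sum over full periods does
-- not see. Each of `r` and `s` runs through `e` periods of length `d`.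
u-hits-block : ∀ e d → 2 ≤ e * d → ∀ y k → let q = e * d in
  sumBelow (q * q) (λ j → 𝟙 (d ∣.∣? u q (k * (q * q) ℕ.+ j) ℕ.+ y)) ≡
  e * (e * sumBelow d (λ s → solutions d s y))
u-hits-block e d 2≤q y k = begin
  sumBelow (q * q) (λ j → 𝟙 (d ∣.∣? u q (k * (q * q) ℕ.+ j) ℕ.+ y))
    ≡⟨ sumBelow-blocks q q ⟩
  sumBelow q (λ s → sumBelow q (λ r → 𝟙 (d ∣.∣? u q (k * (q * q) ℕ.+ (s * q ℕ.+ r)) ℕ.+ y)))
    ≡⟨ sumBelow-cong-< q (λ s s<q → sumBelow-cong-< q (λ r r<q → reduce s r s<q r<q)) ⟩
  sumBelow q (λ s → sumBelow q (λ r → 𝟙 (d ∣.∣? suc r * (c ℕ.+ s) ℕ.+ y)))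
    ≡⟨ sumBelow-cong q (λ s → sumBelow-periods e (hit-periodic′ s)) ⟩
  sumBelow q (λ s → e * sumBelow d (λ r → 𝟙 (d ∣.∣? suc r * (c ℕ.+ s) ℕ.+ y)))
    ≡⟨ sumBelow-*ˡ q e ⟩
  e * sumBelow q (λ s → sumBelow d (λ r → 𝟙 (d ∣.∣? suc r * (c ℕ.+ s) ℕ.+ y)))
    ≡⟨ cong (e *_) (sumBelow-cong q λ s → sumBelow-shift {d = d} (hit-periodic d (c ℕ.+ s) y) 1) ⟩
  e * sumBelow q (λ s → solutions d (c ℕ.+ s) y)
    ≡⟨ cong (e *_) (sumBelow-periods e solutions-periodic′) ⟩
  e * (e * sumBelow d (λ s → solutions d (c ℕ.+ s) y))
    ≡⟨ cong (λ z → e * (e * z)) (sumBelow-shift (solutions-periodic d y) c) ⟩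
  e * (e * sumBelow d (λ s → solutions d s y)) ∎
  where
  open ≡-Reasoning
  q = e * d
  c = k ℕ.+ w q k
  regroup : ∀ t e d z y → t * (e * d) ℕ.+ z ℕ.+ y ≡ t * e * d ℕ.+ (z ℕ.+ y)
  regroup = solve-∀
  reduce : ∀ s r → s < q → r < q →
           𝟙 (d ∣.∣? u q (k * (q * q) ℕ.+ (s * q ℕ.+ r)) ℕ.+ y) ≡ 𝟙 (d ∣.∣? suc r * (c ℕ.+ s) ℕ.+ y)
  reduce s r s<q r<q with u-double-block 2≤q k s r s<q r<q
  ... | t , eq = 𝟙-⇔ (∣-shift (t * e) (trans (cong (ℕ._+ y) eq) (regroup t e d _ y)))
                     (d ∣.∣? _) (d ∣.∣? _)
  hit-periodic′ : ∀ s → Periodic d (λ r → 𝟙 (d ∣.∣? suc r * (c ℕ.+ s) ℕ.+ y))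
  hit-periodic′ s r = trans
    (cong (λ z → 𝟙 (d ∣.∣? z * (c ℕ.+ s) ℕ.+ y)) (sym (ℕ.+-suc d r)))
    (hit-periodic d (c ℕ.+ s) y (suc r))
  solutions-periodic′ : Periodic d (λ s → solutions d (c ℕ.+ s) y)
  solutions-periodic′ s = trans
    (cong (λ z → solutions d z y) (swap c d s))
    (solutions-periodic d y (c ℕ.+ s))
    where
    swap : ∀ c d s → c ℕ.+ (d ℕ.+ s) ≡ d ℕ.+ (c ℕ.+ s)
    swap = solve-∀

-- Density from constant block counts.

countBelow-sumBelow : {T : Pred ℕ p} (T? : Decidable T) (N : ℕ) →
                      countBelow T? N ≡ sumBelow N (λ n → 𝟙 (T? n))
countBelow-sumBelow T? N = length-filter-applyUpTo T? (λ n → n) N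

-- The difference has denominator `m * n` as an unnormalised fraction. The numerator of ε is
-- estimated below by 1, so only its denominator enters the bound.
∣a/m-b/n∣<ε : ∀ a b m n .{{_ : NonZero m}} .{{_ : NonZero n}} (ε : ℚ.ℚ) → 0ℚ ℚ.< ε →
  ∣ a * n ℤ.⊖ b * m ∣ * ℚ.↧ₙ ε < m * n →
  ℚ.∣ (+ a) ℚ./ m ℚ.- (+ b) ℚ./ n ∣ ℚ.< ε
∣a/m-b/n∣<ε a b m@(suc m-1) n@(suc n-1) ε@(ℚ.mkℚ (+ suc e) k _) _ bound =
  ℚ.toℚᵘ-cancel-< (ℚᵘ.<-respˡ-≃ (ℚᵘ.≃-sym toℚᵘ-difference) (ℚᵘ.*<* goal))
  where
  x = ℚᵘ.mkℚᵘ (+ a) m-1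
  y = ℚᵘ.mkℚᵘ (+ b) n-1
  toℚᵘ-difference : ℚ.toℚᵘ ℚ.∣ (+ a) ℚ./ m ℚ.- (+ b) ℚ./ n ∣ ℚᵘ.≃ ℚᵘ.∣ x ℚᵘ.- y ∣
  toℚᵘ-difference =
    ℚᵘ.≃-trans (ℚ.toℚᵘ-homo-∣-∣ ((+ a) ℚ./ m ℚ.- (+ b) ℚ./ n))
    (ℚᵘ.∣-∣-cong
      (ℚᵘ.≃-trans (ℚ.toℚᵘ-homo-+ ((+ a) ℚ./ m) (ℚ.- ((+ b) ℚ./ n)))
      (ℚᵘ.+-cong (ℚ.toℚᵘ-fromℚᵘ x)
        (ℚᵘ.≃-trans (ℚ.toℚᵘ-homo‿- ((+ b) ℚ./ n)) (ℚᵘ.-‿cong (ℚ.toℚᵘ-fromℚᵘ y))))))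
  numerator : (+ a) ℤ.* (+ n) ℤ.+ (ℤ.- (+ b)) ℤ.* (+ m) ≡ a * n ℤ.⊖ b * m
  numerator = trans
    (cong₂ ℤ._+_ (sym (ℤ.pos-* a n))
      (trans (sym (ℤ.neg-distribˡ-* (+ b) (+ m))) (cong ℤ.-_ (sym (ℤ.pos-* b m)))))
    (ℤ.m-n≡m⊖n (a * n) (b * m))
  goal : (+ ∣ (+ a) ℤ.* (+ n) ℤ.+ (ℤ.- (+ b)) ℤ.* (+ m) ∣) ℤ.* (+ suc k) ℤ.<
         (+ suc e) ℤ.* (+ (m * n))
  goal = subst₂ ℤ._<_
    (trans (ℤ.pos-* ∣ a * n ℤ.⊖ b * m ∣ (suc k)) (cong (λ z → (+ ∣ z ∣) ℤ.* (+ suc k)) (sym numerator)))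
    (ℤ.pos-* (suc e) (m * n))
    (ℤ.+<+ (ℕ.<-≤-trans bound (ℕ.m≤n*m (m * n) (suc e))))
∣a/m-b/n∣<ε _ _ _ _ (ℚ.mkℚ (+ zero) _ _) (ℚ.*<* (ℤ.+<+ ())) _
∣a/m-b/n∣<ε _ _ _ _ (ℚ.mkℚ ℤ.-[1+ _ ] _ _) (ℚ.*<* ()) _

-- Full blocks match the proportion C / D exactly and cancel. What remains comes from fewer than `Q`
-- terms, so the bound is independent of `N`.
block-deviation : ∀ Q M D C .{{_ : NonZero Q}} → M * D ≡ C * Q → (∀ i → f i ≤ 1) →
  (∀ k → sumBelow Q (λ j → f (k * Q ℕ.+ j)) ≡ M) →
  ∀ N → ∣ sumBelow N f * D ℤ.⊖ C * N ∣ ≤ Q * D ⊔ C * Q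
block-deviation {f = f} Q M D C MD≡CQ f≤1 block N = begin
  ∣ sumBelow N f * D ℤ.⊖ C * N ∣
    ≡⟨ cong ∣_∣ (cong₂ ℤ._⊖_ count≡ CN≡) ⟩
  ∣ (C * (K * Q) ℕ.+ ρ * D) ℤ.⊖ (C * (K * Q) ℕ.+ C * R) ∣
    ≡⟨ cong ∣_∣ (ℤ.+-cancelˡ-⊖ (C * (K * Q)) (ρ * D) (C * R)) ⟩
  ∣ ρ * D ℤ.⊖ C * R ∣
    ≤⟨ ℤ.∣m⊝n∣≤m⊔n (ρ * D) (C * R) ⟩
  ρ * D ⊔ C * R
    ≤⟨ ℕ.⊔-mono-≤ (ℕ.*-monoˡ-≤ D (ℕ.≤-trans (sumBelow-≤ R λ i → f≤1 (K * Q ℕ.+ i)) R≤Q))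
                  (ℕ.*-monoʳ-≤ C R≤Q) ⟩
  Q * D ⊔ C * Q ∎
  where
  open ℕ.≤-Reasoning
  K = N / Q
  R = N % Q
  R≤Q = m%n≤n N Q
  ρ = sumBelow R (λ i → f (K * Q ℕ.+ i))
  N≡ : N ≡ K * Q ℕ.+ R
  N≡ = trans (m≡m%n+[m/n]*n N Q) (ℕ.+-comm R (K * Q))
  CN≡ : C * N ≡ C * (K * Q) ℕ.+ C * R
  CN≡ = trans (cong (C *_) N≡) (ℕ.*-distribˡ-+ C (K * Q) R)
  expand : ∀ K M ρ D → (K * M ℕ.+ ρ) * D ≡ K * (M * D) ℕ.+ ρ * D
  expand = solve-∀
  swap : ∀ K C Q → K * (C * Q) ≡ C * (K * Q)
  swap = solve-∀
  count≡ : sumBelow N f * D ≡ C * (K * Q) ℕ.+ ρ * D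
  count≡ = begin-equality
    sumBelow N f * D
      ≡⟨ cong (λ n → sumBelow n f * D) N≡ ⟩
    sumBelow (K * Q ℕ.+ R) f * D
      ≡⟨ cong (_* D) (sumBelow-split (K * Q) R) ⟩
    (sumBelow (K * Q) f ℕ.+ ρ) * D
      ≡⟨ cong (λ z → (z ℕ.+ ρ) * D)
           (trans (sumBelow-blocks K Q) (trans (sumBelow-cong K block) (sumBelow-const K M))) ⟩
    (K * M ℕ.+ ρ) * D
      ≡⟨ expand K M ρ D ⟩
    K * (M * D) ℕ.+ ρ * D
      ≡⟨ cong (ℕ._+ ρ * D) (trans (cong (K *_) MD≡CQ) (swap K C Q)) ⟩
    C * (K * Q) ℕ.+ ρ * D ∎

blocks⇒density : {T : Pred ℕ p} (T? : Decidable T) (Q M D C : ℕ)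
  .{{_ : NonZero Q}} .{{_ : NonZero D}} → M * D ≡ C * Q →
  (∀ k → sumBelow Q (λ j → 𝟙 (T? (k * Q ℕ.+ j))) ≡ M) →
  HasNaturalDensity T? ((+ C) ℚ./ D)
-- Since `B` bounds the deviation for all `N`, it suffices that `N` exceed `B` times the denominator
-- of ε.
blocks⇒density T? Q M D C MD≡CQ block ε 0<ε = suc (B * ℚ.↧ₙ ε) , λ N N₀≤N →
  ∣a/m-b/n∣<ε (countBelow T? N) C N D ε 0<ε (begin-strict
    ∣ countBelow T? N * D ℤ.⊖ C * N ∣ * ℚ.↧ₙ ε
      ≡⟨ cong (λ z → ∣ z * D ℤ.⊖ C * N ∣ * ℚ.↧ₙ ε) (countBelow-sumBelow T? N) ⟩
    ∣ sumBelow N (λ n → 𝟙 (T? n)) * D ℤ.⊖ C * N ∣ * ℚ.↧ₙ ε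
      ≤⟨ ℕ.*-monoˡ-≤ (ℚ.↧ₙ ε) (block-deviation Q M D C MD≡CQ (λ n → 𝟙≤1 (T? n)) block N) ⟩
    B * ℚ.↧ₙ ε
      <⟨ N₀≤N ⟩
    N
      ≤⟨ ℕ.m≤m*n N D ⟩
    N * D ∎)
  where
  open ℕ.≤-Reasoning
  B = Q * D ⊔ C * Q

-- From the integer x to its residue mod d.

module _ (d : ℕ) .{{_ : NonZero d}} (x : ℤ) where

  private
    y = x ℤ.%ℕ d
    x≡ : x ≡ + y ℤ.+ (x ℤ./ℕ d) ℤ.* + d
    x≡ = ℤ.a≡a%ℕn+[a/ℕn]*n x d

  -- The numbers `x` and `y` differ by a multiple of `d`, hence of `c`. The case `c = d` transfers
  -- the hits, the other divisors the gcd.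
  ∣-%ℕ : ∀ c → c ∣ d → (n : ℕ) → (+ c ℤ∣.∣ + n ℤ.+ x) ⇔ (c ∣ n ℕ.+ y)
  ∣-%ℕ c c∣d n = mk⇔
    (λ c∣ → ℤ∣.∣⇒∣ᵤ (ℤ∣.∣m+n∣n⇒∣m {m = + (n ℕ.+ y)} (subst (+ c ℤ∣.∣_) eq c∣) c∣kd))
    (λ c∣ → subst (+ c ℤ∣.∣_) (sym eq) (ℤ∣.∣m∣n⇒∣m+n (ℤ∣.∣ᵤ⇒∣ {+ c} {+ (n ℕ.+ y)} c∣) c∣kd))
    where
    kd = (x ℤ./ℕ d) ℤ.* + d
    c∣kd : + c ℤ∣.∣ kd
    c∣kd = ℤ∣.∣n⇒∣m*n (x ℤ./ℕ d) (ℤ∣.∣ᵤ⇒∣ {+ c} {+ d} c∣d)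
    eq : + n ℤ.+ x ≡ + (n ℕ.+ y) ℤ.+ kd
    eq = trans (cong (λ z → + n ℤ.+ z) x≡) (sym (ℤ.+-assoc (+ n) (+ y) kd))

  ∣∣∣⇔∣%ℕ : ∀ c → c ∣ d → (c ∣ ∣ x ∣) ⇔ (c ∣ y)
  ∣∣∣⇔∣%ℕ c c∣d = subst (λ z → (c ∣ ∣ z ∣) ⇔ (c ∣ y)) (ℤ.+-identityˡ x)
    (mk⇔ (λ c∣ → to (ℤ∣.∣ᵤ⇒∣ {+ c} {+ 0 + x} c∣)) (λ c∣ → ℤ∣.∣⇒∣ᵤ (from c∣)))
    where open Equivalence (∣-%ℕ c c∣d 0)

  gcd-%ℕ : gcd ∣ x ∣ d ≡ gcd y d
  gcd-%ℕ = ∣.∣-antisym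
    (gcd-greatest (to (∣∣∣⇔∣%ℕ _ (gcd[m,n]∣n ∣ x ∣ d)) (gcd[m,n]∣m ∣ x ∣ d)) (gcd[m,n]∣n ∣ x ∣ d))
    (gcd-greatest (from (∣∣∣⇔∣%ℕ _ (gcd[m,n]∣n y d)) (gcd[m,n]∣m y d)) (gcd[m,n]∣n y d))
    where open Equivalence using (to; from)

-- The density of the hits.

theorem4p2 : (d q : ℕ) (2≤d : 2 ≤ d) → 2 ≤ q → d ∣ q → (x : ℤ) →
    HasNaturalDensity
    (λ n → (+ d) ∣? (+ u q n + x))
    (ℚ._/_ (+ (∑[ f ∣ gcd ∣ x ∣ d ] (f * φ (d / f)))) (d ^ 2)
    {{m^n≢0 d 2 {{>-nonZero (<⇒≤ 2≤d)}}}})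
theorem4p2 d q 2≤d 2≤q (divides e refl) x =
  -- With q = e d, each block of length q² has e² C hits, and e² C / (e d)² = C / d².
  blocks⇒density (λ n → (+ d) ∣? (+ u q n + x)) (q * q) (e * (e * C)) (d ^ 2) C
    {{ℕ.m*n≢0 q q}} {{m^n≢0 d 2}} (scale e C d) block
  where
  instance
    d≢0 : NonZero d
    d≢0 = >-nonZero (<⇒≤ 2≤d)
    q≢0 : NonZero q
    q≢0 = >-nonZero (<⇒≤ 2≤q)
  y = x ℤ.%ℕ d
  C = ∑[ f ∣ gcd ∣ x ∣ d ] (f * φ (d / f))
  scale : ∀ e C d → e * (e * C) * (d * (d * 1)) ≡ C * (e * d * (e * d))
  scale = solve-∀
  pairs≡C : sumBelow d (λ s → solutions d s y) ≡ C
  pairs≡C = trans (count-pairs d y) (cong (λ g → ∑[ f ∣ g ] (f * φ (d / f))) (sym (gcd-%ℕ d x)))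
  block : ∀ k → sumBelow (q * q) (λ j → 𝟙 ((+ d) ∣? (+ u q (k * (q * q) ℕ.+ j) + x))) ≡ e * (e * C)
  block k = trans
    (sumBelow-cong (q * q) λ j → 𝟙-⇔ (∣-%ℕ d x d ∣.∣-refl _) ((+ d) ∣? _) (d ∣.∣? _))
    (trans (u-hits-block e d 2≤q y k) (cong (λ z → e * (e * z)) pairs≡C))
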